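{- The following problem is undecidable: given an LTL formula $\psi$ and a HyperLTL formula $\varphi=\forall\pi\exists\pi_1\ldots\exists\pi_k\mathpunct{.}(\mathsf{F}\,\phi_1)\wedge(\mathsf{F}\,\phi_2)\wedge\phi'$, where $\phi_1,\phi_2,\phi'$ contain no temporal operators, decide whether the specification $(\psi,\varphi)$ is satisfiable.
   Context: Fix a finite set $\mathit{AP}$ of atomic propositions and $\Sigma=2^{\mathit{AP}}$; traces are elements of $\Sigma^\omega$. LTL: $\psi ::= a \mid \neg\psi \mid \psi\wedge\psi \mid \mathsf{X}\psi \mid \psi\,\mathsf{U}\,\psi$ with standard semantics, $\mathsf{F}\psi=\top\mathsf{U}\psi$. HyperLTL: $\varphi ::= \exists\pi\mathpunct{.}\varphi \mid \forall\pi\mathpunct{.}\varphi \mid \phi$, $\phi ::= a_\pi \mid \neg\phi\mid\phi\wedge\phi\mid\mathsf{X}\phi\mid\phi\,\mathsf{U}\,\phi$ (closed); semantics w.r.t. a set of traces $T$: $a_\pi$ holds iff $a$ is in the current letter of the trace bound to $\pi$, temporal operators shift all bound traces synchronously, quantifiers range over $T$. A specification $(\psi,\varphi)$ is satisfiable iff there is a non-empty $T\subseteq\Sigma^\omega$ such that every $t\in T$ satisfies $\psi$ and $T\models\varphi$. -}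

module Defs where

open import Data.Nat using (ℕ; zero; suc; _+_; _<_)
open import Data.Fin using (Fin; zero; suc)
open import Data.Bool using (Bool; true; false; T)
open import Data.Maybe using (Maybe; just; nothing)
open import Data.Product using (Σ; ∃; _×_; _,_)
open import Data.Empty using (⊥)
open import Data.Unit using (⊤)
open import Relation.Nullary using (¬_; Dec)
open import Relation.Binary.PropositionalEquality using (_≡_)

-- Traces over AP = Fin n, Σ = 2^AP represented as Fin n → Bool

Letter : ℕ → Set
Letter n = Fin n → Bool

Trace : ℕ → Set
Trace n = ℕ → Letter n

data LTL (n : ℕ) : Set where
  atom : Fin n → LTL n
  neg  : LTL n → LTL n
  _∧_  : LTL n → LTL n → LTL n
  X    : LTL n → LTL n
  _U_  : LTL n → LTL n → LTL n

_,_⊨L_ : {n : ℕ} → Trace n → ℕ → LTL n → Set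
t , i ⊨L atom a = T (t i a)
t , i ⊨L neg ψ = ¬ (t , i ⊨L ψ)
t , i ⊨L (ψ ∧ χ) = (t , i ⊨L ψ) × (t , i ⊨L χ)
t , i ⊨L X ψ = t , suc i ⊨L ψ
t , i ⊨L (ψ U χ) =
  Σ ℕ λ j → (t , (i + j) ⊨L χ) × (∀ l → l < j → t , (i + l) ⊨L ψ)

-- HyperLTL: quantifier-free bodies over m trace variables (de Bruijn,
-- Fin m), and quantifier prefixes.

data Body (n m : ℕ) : Set where
  atom : Fin n → Fin m → Body n m
  neg  : Body n m → Body n m
  _∧_  : Body n m → Body n m → Body n m
  X    : Body n m → Body n m
  _U_  : Body n m → Body n m → Body n m

data Hyper (n : ℕ) : ℕ → Set where
  ex   : {m : ℕ} → Hyper n (suc m) → Hyper n m   -- ∃π. (binds variable zero)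
  all  : {m : ℕ} → Hyper n (suc m) → Hyper n m   -- ∀π. (binds variable zero)
  body : {m : ℕ} → Body n m → Hyper n m

HyperLTL : ℕ → Set
HyperLTL n = Hyper n 0

tt' : {n m : ℕ} → Body n m → Body n m
tt' φ = neg (φ ∧ neg φ)

F : {n m : ℕ} → Body n m → Body n m
F φ = tt' φ U φ

data NoTemporal {n m : ℕ} : Body n m → Set where
  atom : ∀ a π → NoTemporal (atom a π)
  neg  : ∀ {φ} → NoTemporal φ → NoTemporal (neg φ)
  and  : ∀ {φ χ} → NoTemporal φ → NoTemporal χ → NoTemporal (φ ∧ χ)

extend : {n m : ℕ} → Trace n → (Fin m → Trace n) → Fin (suc m) → Trace n
extend t Π zero = t
extend t Π (suc π) = Π π

_,_⊨B_ : {n m : ℕ} → (Fin m → Trace n) → ℕ → Body n m → Set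
Π , i ⊨B atom a π = T (Π π i a)
Π , i ⊨B neg φ = ¬ (Π , i ⊨B φ)
Π , i ⊨B (φ ∧ χ) = (Π , i ⊨B φ) × (Π , i ⊨B χ)
Π , i ⊨B X φ = Π , suc i ⊨B φ
Π , i ⊨B (φ U χ) =
  Σ ℕ λ j → (Π , (i + j) ⊨B χ) × (∀ l → l < j → Π , (i + l) ⊨B φ)

_,_⊨H_ : {n m : ℕ} → (Trace n → Set) → (Fin m → Trace n) → Hyper n m → Set
T' , Π ⊨H ex φ = Σ (Trace _) λ t → T' t × (T' , extend t Π ⊨H φ)
T' , Π ⊨H all φ = ∀ t → T' t → T' , extend t Π ⊨H φ
T' , Π ⊨H body φ = Π , 0 ⊨B φ

emptyAssign : {n : ℕ} → Fin 0 → Trace n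
emptyAssign ()

_⊨_ : {n : ℕ} → (Trace n → Set) → HyperLTL n → Set
T' ⊨ φ = T' , emptyAssign ⊨H φ

Satisfiable : {n : ℕ} → LTL n → HyperLTL n → Set₁
Satisfiable {n} ψ φ =
  Σ (Trace n → Set) λ T' →
    (∃ λ t → T' t) × (∀ t → T' t → t , 0 ⊨L ψ) × (T' ⊨ φ)

-- The fragment  ∀π ∃π₁ … ∃πₖ. (F φ₁) ∧ (F φ₂) ∧ φ'
-- (φ₁ φ₂ φ' have k+1 free trace variables; the ∀-bound π is the
--  outermost binder, i.e. variable index k; πᵢ are the others)
exs : {n : ℕ} (k : ℕ) → Hyper n (suc k) → Hyper n 1
exs zero φ = φ
exs (suc k) φ = exs k (ex φ)

fragment : {n : ℕ} (k : ℕ) → (φ₁ φ₂ φ' : Body n (suc k)) → HyperLTL n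
fragment k φ₁ φ₂ φ' = all (exs k (body ((F φ₁ ∧ F φ₂) ∧ φ')))

-- Reference undecidable problem: halting of two-counter (Minsky)
-- machines started in instruction 0 with both counters 0.

data Instr (L : ℕ) : Set where
  inc  : Bool → Fin L → Instr L          -- increment counter c, goto j
  jzdec : Bool → Fin L → Fin L → Instr L -- if counter c = 0 goto j₀ else decrement, goto j₁
  halt : Instr L

record Minsky : Set where
  field
    size : ℕ
    prog : Fin (suc size) → Instr (suc size)

Config : ℕ → Set
Config L = Fin L × ℕ × ℕ

getC : Bool → ℕ × ℕ → ℕ
getC false (a , b) = a
getC true  (a , b) = b

setC : Bool → ℕ → ℕ × ℕ → ℕ × ℕ
setC false v (a , b) = (v , b)
setC true  v (a , b) = (a , v)

-- one step; nothing = the machine has halted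
step : (M : Minsky) → Config (suc (Minsky.size M)) → Maybe (Config (suc (Minsky.size M)))
step M (q , cs) with Minsky.prog M q
... | inc c j = just (j , setC c (suc (getC c cs)) cs)
... | jzdec c j₀ j₁ with getC c cs
...   | zero = just (j₀ , cs)
...   | suc v = just (j₁ , setC c v cs)
step M (q , cs) | halt = nothing

run : (M : Minsky) → ℕ → Maybe (Config (suc (Minsky.size M)))
run M zero = just (zero , 0 , 0)
run M (suc s) with run M s
... | nothing = nothing
... | just c = step M c

Halts : Minsky → Set
Halts M = ∃ λ s → run M s ≡ nothing

-- A two-counter machine M is reduced to a specification (ψ, φ).  A trace describes the
-- configuration reached at time t as seen by an observer of one counter b: t and the value of
-- counter b are the unique positions of the atoms time and counter, and the state is read off at
-- position 0.  The LTL formula ψ makes each trace mark the successor state and the new position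
-- of its counter (atoms nextState and moved); these depend only on the zero tests of the two
-- counters, the test of the other counter being the bit otherZero.  The HyperLTL formula φ asks
-- of every trace π for a predecessor π₁, one time step earlier and observing the same counter,
-- whose markers agree with π; for a twin π₂ at the same time observing the other counter, which
-- certifies otherZero; and for a trace π₃ without successor state.  By induction on t, in every
-- model all traces at time t describe the t-th configuration of the run, so π₃ shows that M
-- halts.  Conversely, the traces of all configurations of a halting run, for both observers,
-- form a model.

module Submission where

open import Defs
open import Data.Bool using (Bool; true; false; T; not; T?; if_then_else_)
open import Data.Bool.Properties using () renaming (_≟_ to _≟ᵇ_)
open import Data.Empty using (⊥-elim)
open import Data.Fin using (Fin; zero; suc; _↑ˡ_; _↑ʳ_; splitAt)
open import Data.Fin.Properties using (splitAt-↑ˡ; splitAt-↑ʳ; any?) renaming (_≟_ to _≟ᶠ_)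
open import Data.Maybe using (Maybe; just; nothing)
open import Data.Maybe.Properties using (just-injective)
open import Data.Nat using (ℕ; zero; suc; _+_; _<_; s≤s; _≡ᵇ_; _<ᵇ_)
open import Data.Nat.Properties
  using (≡ᵇ⇒≡; ≡⇒≡ᵇ; <ᵇ⇒<; <⇒<ᵇ; <-cmp; <-irrefl; m<n⇒m<1+n; n<1+n; m≤n⇒m<n∨m≡n)
open import Data.Product using (∃; ∃₂; _×_; _,_; proj₁; proj₂)
open import Data.Sum using (_⊎_; inj₁; inj₂; [_,_]′; map₂)
open import Function using (id; _∘_)
open import Relation.Binary.Definitions using (tri<; tri≈; tri>)
open import Relation.Binary.PropositionalEquality using (_≡_; refl; sym; trans; cong; subst)
open import Relation.Nullary using (¬_; Dec; yes; no; does)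
open import Relation.Nullary.Decidable
  using (dec-true; decidable-stable; _×-dec_; toWitness; isYes≗does; map′)
open import Relation.Nullary.Negation using (Stable; negated-stable; contradiction)

-- The derived connectives unfold to negations; reading them back needs ¬¬-stability, which
-- holds for atoms since they are decidable.

module _ {A B : Set} where

  ⇒-intro : (A → B) → ¬ (A × ¬ B)
  ⇒-intro f (a , ¬b) = ¬b (f a)

  ⇒-elim : Stable B → ¬ (A × ¬ B) → A → B
  ⇒-elim stable h a = stable (λ ¬b → h (a , ¬b))

  ∨-introˡ : A → ¬ (¬ A × ¬ B)
  ∨-introˡ a (¬a , _) = ¬a a

  ∨-introʳ : B → ¬ (¬ A × ¬ B)
  ∨-introʳ b (_ , ¬b) = ¬b b

  ∨-elim : Dec A → Stable B → ¬ (¬ A × ¬ B) → A ⊎ B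
  ∨-elim (yes a) _      _ = inj₁ a
  ∨-elim (no ¬a) stable h = inj₂ (stable (λ ¬b → h (¬a , ¬b)))

  ×-stable : Stable A → Stable B → Stable (A × B)
  ×-stable sA sB ¬¬ab = sA (λ ¬a → ¬¬ab (¬a ∘ proj₁)) , sB (λ ¬b → ¬¬ab (¬b ∘ proj₂))

T-stable : (b : Bool) → Stable (T b)
T-stable b = decidable-stable (T? b)

≡ᵇ-refl : ∀ n → T (n ≡ᵇ n)
≡ᵇ-refl n = ≡⇒≡ᵇ n n refl

⇔-stable : {A B : Set} → Stable (¬ (A × ¬ B) × ¬ (B × ¬ A))
⇔-stable = ×-stable negated-stable negated-stable

T-⇔⇒≡ : {x y : Bool} → ¬ (T x × ¬ T y) × ¬ (T y × ¬ T x) → x ≡ y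
T-⇔⇒≡ {false} {false} _         = refl
T-⇔⇒≡ {false} {true}  (_ , y⇒x) = ⊥-elim (y⇒x (_ , id))
T-⇔⇒≡ {true}  {false} (x⇒y , _) = ⊥-elim (x⇒y (_ , id))
T-⇔⇒≡ {true}  {true}  _         = refl

≡⇒T-⇔ : {x y : Bool} → x ≡ y → ¬ (T x × ¬ T y) × ¬ (T y × ¬ T x)
≡⇒T-⇔ refl = ⇒-intro id , ⇒-intro id

T-⇔¬⇒≡not : {x y : Bool} → ¬ (T x × ¬ ¬ T y) × ¬ (¬ T y × ¬ T x) → x ≡ not y
T-⇔¬⇒≡not {false} {false} (_ , ¬y⇒x) = ⊥-elim (¬y⇒x (id , id))
T-⇔¬⇒≡not {false} {true}  _          = refl
T-⇔¬⇒≡not {true}  {false} _          = refl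
T-⇔¬⇒≡not {true}  {true}  (x⇒¬y , _) = ⊥-elim (x⇒¬y (_ , λ ¬y → ¬y _))

≡not⇒T-⇔¬ : {x y : Bool} → x ≡ not y → ¬ (T x × ¬ ¬ T y) × ¬ (¬ T y × ¬ T x)
≡not⇒T-⇔¬ {y = false} refl = (λ (_ , ¬¬y) → ¬¬y id) , (λ (_ , ¬x) → ¬x _)
≡not⇒T-⇔¬ {y = true}  refl = (λ (x , _) → x) , (λ (¬y , _) → ¬y _)

module _ {n : ℕ} where

  infixr 5 _⇒_
  infix  5 _⇔_
  infixr 6 _∨_
  infix  30 □_ ◇_

  ⊤L : LTL (suc n)
  ⊤L = neg (atom zero ∧ neg (atom zero))

  _⇒_ _∨_ _⇔_ : LTL (suc n) → LTL (suc n) → LTL (suc n)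
  φ ⇒ χ = neg (φ ∧ neg χ)
  φ ∨ χ = neg (neg φ ∧ neg χ)
  φ ⇔ χ = (φ ⇒ χ) ∧ (χ ⇒ φ)

  □_ ◇_ : LTL (suc n) → LTL (suc n)
  □ φ = neg (⊤L U neg φ)
  ◇ φ = ⊤L U φ

  lit : Bool → Fin (suc n) → LTL (suc n)
  lit true  a = atom a
  lit false a = neg (atom a)

  ⋀ : ∀ {m} → (Fin (suc m) → LTL (suc n)) → LTL (suc n)
  ⋀ {zero}  f = f zero
  ⋀ {suc m} f = f zero ∧ ⋀ (f ∘ suc)

  ⋀ᵇ : (Bool → LTL (suc n)) → LTL (suc n)
  ⋀ᵇ f = f false ∧ f true

  module _ (τ : Trace (suc n)) where

    ⊤L-holds : ∀ i → τ , i ⊨L ⊤L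
    ⊤L-holds i (a , ¬a) = ¬a a

    □-intro : ∀ φ → (∀ j → τ , j ⊨L φ) → τ , 0 ⊨L □ φ
    □-intro φ always (j , ¬φ , _) = ¬φ (always j)

    □-elim : ∀ φ → (∀ j → Stable (τ , j ⊨L φ)) → τ , 0 ⊨L □ φ → ∀ j → τ , j ⊨L φ
    □-elim φ stable □φ j = stable j (λ ¬φ → □φ (j , ¬φ , λ l _ → ⊤L-holds l))

    □⇔-elim : ∀ φ χ → (∀ j → Stable (τ , j ⊨L χ)) → τ , 0 ⊨L □ (φ ⇔ χ) → ∀ j → τ , j ⊨L φ → τ , j ⊨L χ
    □⇔-elim φ χ stable □φ⇔χ j = ⇒-elim (stable j) (proj₁ (□-elim (φ ⇔ χ) (λ _ → ⇔-stable) □φ⇔χ j))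

    ◇-intro : ∀ φ j → τ , j ⊨L φ → τ , 0 ⊨L ◇ φ
    ◇-intro φ j φ-j = j , φ-j , λ l _ → ⊤L-holds l

    lit-intro : ∀ {i a b} → τ i a ≡ b → τ , i ⊨L lit b a
    lit-intro {b = true}  e = subst T (sym e) _
    lit-intro {b = false} e = subst T e

    lit-elim : ∀ {i a} b → τ , i ⊨L lit b a → τ i a ≡ b
    lit-elim {i} {a} true  h with τ i a
    ... | true = refl
    lit-elim {i} {a} false h with τ i a
    ... | true  = ⊥-elim (h _)
    ... | false = refl

    lit-stable : ∀ {i a} b → Stable (τ , i ⊨L lit b a)
    lit-stable true  = T-stable _
    lit-stable false = negated-stable

    module _ {i : ℕ} where

      ⋀-intro : ∀ {m} (f : Fin (suc m) → LTL (suc n)) → (∀ q → τ , i ⊨L f q) → τ , i ⊨L ⋀ f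
      ⋀-intro {zero}  f h = h zero
      ⋀-intro {suc m} f h = h zero , ⋀-intro (f ∘ suc) (h ∘ suc)

      ⋀-elim : ∀ {m} (f : Fin (suc m) → LTL (suc n)) → τ , i ⊨L ⋀ f → ∀ q → τ , i ⊨L f q
      ⋀-elim {zero}  f h zero    = h
      ⋀-elim {suc m} f h zero    = proj₁ h
      ⋀-elim {suc m} f h (suc q) = ⋀-elim (f ∘ suc) (proj₂ h) q

      ⋀-stable : ∀ {m} (f : Fin (suc m) → LTL (suc n)) →
        (∀ q → Stable (τ , i ⊨L f q)) → Stable (τ , i ⊨L ⋀ f)
      ⋀-stable {zero}  f s = s zero
      ⋀-stable {suc m} f s = ×-stable (s zero) (⋀-stable (f ∘ suc) (s ∘ suc))

      ⋀ᵇ-elim : ∀ f → τ , i ⊨L ⋀ᵇ f → ∀ b → τ , i ⊨L f b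
      ⋀ᵇ-elim f h false = proj₁ h
      ⋀ᵇ-elim f h true  = proj₂ h

      ⋀ᵇ-intro : ∀ f → (∀ b → τ , i ⊨L f b) → τ , i ⊨L ⋀ᵇ f
      ⋀ᵇ-intro f h = h false , h true

      ⋀ᵇ-stable : ∀ f → (∀ b → Stable (τ , i ⊨L f b)) → Stable (τ , i ⊨L ⋀ᵇ f)
      ⋀ᵇ-stable f s = ×-stable (s false) (s true)

module _ {n m : ℕ} where

  infixr 5 _⇒ᴮ_
  infix  5 _⇔ᴮ_
  infixr 6 _∨ᴮ_

  _⇒ᴮ_ _∨ᴮ_ _⇔ᴮ_ : Body n m → Body n m → Body n m
  φ ⇒ᴮ χ = neg (φ ∧ neg χ)
  φ ∨ᴮ χ = neg (neg φ ∧ neg χ)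
  φ ⇔ᴮ χ = (φ ⇒ᴮ χ) ∧ (χ ⇒ᴮ φ)

  -- nonempty conjunctions, since Body has no constant ⊤
  ⋀ᴮ : ∀ {k} → (Fin (suc k) → Body n m) → Body n m
  ⋀ᴮ {zero}  f = f zero
  ⋀ᴮ {suc k} f = f zero ∧ ⋀ᴮ (f ∘ suc)

  ⇒ᴮ-noTemporal : ∀ {φ χ} → NoTemporal φ → NoTemporal χ → NoTemporal (φ ⇒ᴮ χ)
  ⇒ᴮ-noTemporal φ χ = neg (and φ (neg χ))

  ∨ᴮ-noTemporal : ∀ {φ χ} → NoTemporal φ → NoTemporal χ → NoTemporal (φ ∨ᴮ χ)
  ∨ᴮ-noTemporal φ χ = neg (and (neg φ) (neg χ))

  ⇔ᴮ-noTemporal : ∀ {φ χ} → NoTemporal φ → NoTemporal χ → NoTemporal (φ ⇔ᴮ χ)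
  ⇔ᴮ-noTemporal φ χ = and (⇒ᴮ-noTemporal φ χ) (⇒ᴮ-noTemporal χ φ)

  ⋀ᴮ-noTemporal : ∀ {k} (f : Fin (suc k) → Body n m) → (∀ q → NoTemporal (f q)) → NoTemporal (⋀ᴮ f)
  ⋀ᴮ-noTemporal {zero}  f h = h zero
  ⋀ᴮ-noTemporal {suc k} f h = and (h zero) (⋀ᴮ-noTemporal (f ∘ suc) (h ∘ suc))

  module _ (Π : Fin m → Trace n) where

    F-intro : ∀ φ j → Π , j ⊨B φ → Π , 0 ⊨B F φ
    F-intro φ j φ-j = j , φ-j , λ _ _ (χ , ¬χ) → ¬χ χ

    module _ {i : ℕ} where

      ⋀ᴮ-intro : ∀ {k} (f : Fin (suc k) → Body n m) → (∀ q → Π , i ⊨B f q) → Π , i ⊨B ⋀ᴮ f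
      ⋀ᴮ-intro {zero}  f h = h zero
      ⋀ᴮ-intro {suc k} f h = h zero , ⋀ᴮ-intro (f ∘ suc) (h ∘ suc)

      ⋀ᴮ-elim : ∀ {k} (f : Fin (suc k) → Body n m) → Π , i ⊨B ⋀ᴮ f → ∀ q → Π , i ⊨B f q
      ⋀ᴮ-elim {zero}  f h zero    = h
      ⋀ᴮ-elim {suc k} f h zero    = proj₁ h
      ⋀ᴮ-elim {suc k} f h (suc q) = ⋀ᴮ-elim (f ∘ suc) (proj₂ h) q

      ⋀ᴮ-stable : ∀ {k} (f : Fin (suc k) → Body n m) →
        (∀ q → Stable (Π , i ⊨B f q)) → Stable (Π , i ⊨B ⋀ᴮ f)
      ⋀ᴮ-stable {zero}  f s = s zero
      ⋀ᴮ-stable {suc k} f s = ×-stable (s zero) (⋀ᴮ-stable (f ∘ suc) (s ∘ suc))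

-- Two-counter machines as seen from one counter

data Move : Set where
  stay up down : Move

data Moves : Move → ℕ → ℕ → Set where
  stay : ∀ {v} → Moves stay v v
  up   : ∀ {v} → Moves up v (suc v)
  down : ∀ {v} → Moves down (suc v) v

Moves-functional : ∀ {m v w w′} → Moves m v w → Moves m v w′ → w ≡ w′
Moves-functional stay stay = refl
Moves-functional up   up   = refl
Moves-functional down down = refl

getC-zeros : ∀ b → getC b (0 , 0) ≡ 0
getC-zeros false = refl
getC-zeros true  = refl

module _ {L : ℕ} where

  stepI : Instr L → ℕ × ℕ → Maybe (Config L)
  stepI (inc c j)       cs = just (j , setC c (suc (getC c cs)) cs)
  stepI (jzdec c j₀ j₁) cs with getC c cs
  ... | zero  = just (j₀ , cs)
  ... | suc v = just (j₁ , setC c v cs)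
  stepI halt            cs = nothing

  -- What an observer of counter b learns about a step from the zero tests of counter b and of
  -- the other counter: the successor state and how counter b moves.
  observedStep : Instr L → Bool → Bool → Bool → Maybe (Fin L × Move)
  observedStep (inc c j)       b _       _         = just (j , (if does (c ≟ᵇ b) then up else stay))
  observedStep (jzdec c j₀ j₁) b ownZero otherZero =
    if does (c ≟ᵇ b)
    then (if ownZero then just (j₀ , stay) else just (j₁ , down))
    else just ((if otherZero then j₀ else j₁) , stay)
  observedStep halt            _ _       _         = nothing

  data Observed (b : Bool) (cs : ℕ × ℕ) : Maybe (Config L) → Maybe (Fin L × Move) → Set where
    halted : Observed b cs nothing nothing
    moved  : ∀ {j m cs′} → Moves m (getC b cs) (getC b cs′) → Observed b cs (just (j , cs′)) (just (j , m))

  observedStep-correct : ∀ ins b x y →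
    Observed b (x , y) (stepI ins (x , y))
      (observedStep ins b (0 ≡ᵇ getC b (x , y)) (0 ≡ᵇ getC (not b) (x , y)))
  observedStep-correct (inc false j)       false x       y       = moved up
  observedStep-correct (inc false j)       true  x       y       = moved stay
  observedStep-correct (inc true  j)       false x       y       = moved stay
  observedStep-correct (inc true  j)       true  x       y       = moved up
  observedStep-correct (jzdec false j₀ j₁) false zero    y       = moved stay
  observedStep-correct (jzdec false j₀ j₁) false (suc x) y       = moved down
  observedStep-correct (jzdec false j₀ j₁) true  zero    y       = moved stay
  observedStep-correct (jzdec false j₀ j₁) true  (suc x) y       = moved stay
  observedStep-correct (jzdec true  j₀ j₁) false x       zero    = moved stay
  observedStep-correct (jzdec true  j₀ j₁) false x       (suc y) = moved stay
  observedStep-correct (jzdec true  j₀ j₁) true  x       zero    = moved stay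
  observedStep-correct (jzdec true  j₀ j₁) true  x       (suc y) = moved down
  observedStep-correct halt                b     x       y       = halted

module _ (M : Minsky) where
  open Minsky M using (prog)

  step≡stepI : ∀ q cs → step M (q , cs) ≡ stepI (prog q) cs
  step≡stepI q cs with prog q
  ... | inc c j = refl
  ... | halt    = refl
  ... | jzdec c j₀ j₁ with getC c cs
  ...   | zero  = refl
  ...   | suc v = refl

  step-observed : ∀ b q x y →
    Observed b (x , y) (step M (q , x , y))
      (observedStep (prog q) b (0 ≡ᵇ getC b (x , y)) (0 ≡ᵇ getC (not b) (x , y)))
  step-observed b q x y rewrite step≡stepI q (x , y) = observedStep-correct (prog q) b x y

  run-suc : ∀ {t c} → run M t ≡ just c → run M (suc t) ≡ step M c
  run-suc {t} e with run M t
  run-suc refl | just c = refl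

  run-pred : ∀ t {c} → run M (suc t) ≡ just c → ∃ λ c₀ → run M t ≡ just c₀ × step M c₀ ≡ just c
  run-pred t e with run M t in e₀
  ... | just c₀ = c₀ , refl , e

  run-last : ∀ s → run M s ≡ nothing → ∃₂ λ t c → run M t ≡ just c × step M c ≡ nothing
  run-last (suc s) e with run M s in e₀
  ... | nothing = run-last s e₀
  ... | just c  = s , c , e₀ , e


module Reduction (M : Minsky) where
  open Minsky M using (size; prog)

  L : ℕ
  L = suc size

  data Atom : Set where
    init time next counter moved timeSeen counterSeen owner otherZero : Atom
    state nextState : Fin L → Atom

  N : ℕ
  N = 9 + (L + L)

  code : Atom → Fin N
  code init           = zero
  code time           = suc zero
  code next           = suc (suc zero)
  code counter        = suc (suc (suc zero))
  code moved          = suc (suc (suc (suc zero)))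
  code timeSeen       = suc (suc (suc (suc (suc zero))))
  code counterSeen    = suc (suc (suc (suc (suc (suc zero)))))
  code owner          = suc (suc (suc (suc (suc (suc (suc zero))))))
  code otherZero      = suc (suc (suc (suc (suc (suc (suc (suc zero)))))))
  code (state q)      = 9 ↑ʳ (q ↑ˡ L)
  code (nextState q)  = 9 ↑ʳ (L ↑ʳ q)

  decode : Fin N → Atom
  decode zero                                                          = init
  decode (suc zero)                                                    = time
  decode (suc (suc zero))                                              = next
  decode (suc (suc (suc zero)))                                        = counter
  decode (suc (suc (suc (suc zero))))                                  = moved
  decode (suc (suc (suc (suc (suc zero)))))                            = timeSeen
  decode (suc (suc (suc (suc (suc (suc zero))))))                      = counterSeen
  decode (suc (suc (suc (suc (suc (suc (suc zero)))))))                = owner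
  decode (suc (suc (suc (suc (suc (suc (suc (suc zero))))))))          = otherZero
  decode (suc (suc (suc (suc (suc (suc (suc (suc (suc x))))))))) = [ state , nextState ]′ (splitAt L x)

  decode-code : ∀ a → decode (code a) ≡ a
  decode-code init          = refl
  decode-code time          = refl
  decode-code next          = refl
  decode-code counter       = refl
  decode-code moved         = refl
  decode-code timeSeen      = refl
  decode-code counterSeen   = refl
  decode-code owner         = refl
  decode-code otherZero     = refl
  decode-code (state q)     = cong [ state , nextState ]′ (splitAt-↑ˡ L q L)
  decode-code (nextState q) = cong [ state , nextState ]′ (splitAt-↑ʳ L L q)

  Tr : Set
  Tr = Trace N

  holds : Tr → ℕ → Atom → Bool
  holds τ i a = τ i (code a)

  ⟪_⟫ : Atom → LTL N
  ⟪ a ⟫ = atom (code a)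

  infix 30 _⟨_⟩

  _⟨_⟩ : Atom → Fin 4 → Body N 4
  a ⟨ v ⟩ = atom (code a) v

  AtMostOnce : Tr → Atom → Set
  AtMostOnce τ a = ∀ i j → T (holds τ i a) → T (holds τ j a) → i ≡ j

  Marker : Tr → Atom → ℕ → Set
  Marker τ a p = ∀ i → holds τ i a ≡ (i ≡ᵇ p)

  StateIs : Tr → (Fin L → Atom) → Fin L → Set
  StateIs τ f j = ∀ q → holds τ 0 (f q) ≡ does (q ≟ᶠ j)

  unique⇒marker : ∀ τ a {p} → AtMostOnce τ a → T (holds τ p a) → Marker τ a p
  unique⇒marker τ a {p} unique at-p i with holds τ i a in e | i ≡ᵇ p in e′
  ... | true  | true  = refl
  ... | false | false = refl
  ... | true  | false = contradiction (≡⇒≡ᵇ i p (unique i p (subst T (sym e) _) at-p)) (subst T e′)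
  ... | false | true  =
    contradiction (subst (λ k → T (holds τ k a)) (sym (≡ᵇ⇒≡ i p (subst T (sym e′) _))) at-p) (subst T e)

  marker⇒≡ : ∀ τ a {p} → Marker τ a p → ∀ i → T (holds τ i a) → i ≡ p
  marker⇒≡ τ a {p} m i h = ≡ᵇ⇒≡ i p (subst T (m i) h)

  -- The LTL specification ψ

  -- seen is forced to hold after any occurrence of x, and excludes x
  spreads excludes atMostOnce : Atom → Atom → LTL N
  spreads seen x = (⟪ seen ⟫ ∨ ⟪ x ⟫) ⇒ X ⟪ seen ⟫
  excludes seen x = ⟪ seen ⟫ ⇒ neg ⟪ x ⟫
  atMostOnce seen x = □ (spreads seen x) ∧ □ (excludes seen x)

  atMostOnce-sound : ∀ τ seen x → τ , 0 ⊨L atMostOnce seen x → AtMostOnce τ x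
  atMostOnce-sound τ seen x (□spreads , □excludes) = unique
    where
    spread : ∀ j → τ , j ⊨L (⟪ seen ⟫ ∨ ⟪ x ⟫) → T (holds τ (suc j) seen)
    spread = ⇒-elim (T-stable _) ∘ □-elim τ (spreads seen x) (λ _ → negated-stable) □spreads
    seen-after : ∀ {i} → T (holds τ i x) → ∀ j → i < j → T (holds τ j seen)
    seen-after x-i (suc j) (s≤s i≤j) with m≤n⇒m<n∨m≡n i≤j
    ... | inj₁ i<j  = spread j (∨-introˡ (seen-after x-i j i<j))
    ... | inj₂ refl = spread j (∨-introʳ x-i)
    excluded : ∀ j → T (holds τ j seen) → ¬ T (holds τ j x)
    excluded = ⇒-elim negated-stable ∘ □-elim τ (excludes seen x) (λ _ → negated-stable) □excludes
    unique : AtMostOnce τ x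
    unique i j x-i x-j with <-cmp i j
    ... | tri< i<j _ _ = contradiction x-j (excluded j (seen-after x-i j i<j))
    ... | tri≈ _ i≡j _ = i≡j
    ... | tri> _ _ j<i = contradiction x-i (excluded i (seen-after x-j i j<i))

  atMostOnce-complete : ∀ τ seen x p → (∀ i → holds τ i seen ≡ (p <ᵇ i)) → Marker τ x p →
    τ , 0 ⊨L atMostOnce seen x
  atMostOnce-complete τ seen x p seen≡ x≡ =
      □-intro τ (spreads seen x) (λ j → ⇒-intro (spread j))
    , □-intro τ (excludes seen x) (λ j → ⇒-intro (excluded j))
    where
    after : ∀ {i} → p < i → T (holds τ i seen)
    after {i} p<i = subst T (sym (seen≡ i)) (<⇒<ᵇ p<i)
    at : ∀ {i} → T (holds τ i x) → i ≡ p
    at {i} x-i = ≡ᵇ⇒≡ i p (subst T (x≡ i) x-i)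
    spread : ∀ j → τ , j ⊨L (⟪ seen ⟫ ∨ ⟪ x ⟫) → T (holds τ (suc j) seen)
    spread j h = T-stable _ λ ¬next → h
      ( (λ s-j → ¬next (after (m<n⇒m<1+n (<ᵇ⇒< p j (subst T (seen≡ j) s-j)))))
      , (λ x-j → ¬next (after (subst (λ k → p < suc k) (sym (at x-j)) (n<1+n p)))) )
    excluded : ∀ j → T (holds τ j seen) → ¬ T (holds τ j x)
    excluded j s-j x-j = <-irrefl (sym (at x-j)) (<ᵇ⇒< p j (subst T (seen≡ j) s-j))

  stateBit : (Fin L → Atom) → Fin L → Fin L → LTL N
  stateBit f j q = lit (does (q ≟ᶠ j)) (code (f q))

  stateIs : (Fin L → Atom) → Fin L → LTL N
  stateIs f j = ⋀ (stateBit f j)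

  stateIs-sound : ∀ τ f j → τ , 0 ⊨L stateIs f j → StateIs τ f j
  stateIs-sound τ f j h q = lit-elim τ _ (⋀-elim τ (stateBit f j) h q)

  stateIs-complete : ∀ τ f j → StateIs τ f j → τ , 0 ⊨L stateIs f j
  stateIs-complete τ f j h = ⋀-intro τ (stateBit f j) (λ q → lit-intro τ (h q))

  stateIs-stable : ∀ τ f j → Stable (τ , 0 ⊨L stateIs f j)
  stateIs-stable τ f j = ⋀-stable τ (stateBit f j) (λ q → lit-stable τ (does (q ≟ᶠ j)))

  stateIs-self : ∀ τ f j → StateIs τ f j → T (holds τ 0 (f j))
  stateIs-self τ f j s = subst T (sym (trans (s j) (dec-true (j ≟ᶠ j) refl))) _

  movement : Move → LTL N
  movement stay = □ (⟪ moved ⟫ ⇔ ⟪ counter ⟫)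
  movement up   = □ (X ⟪ moved ⟫ ⇔ ⟪ counter ⟫) ∧ neg ⟪ moved ⟫
  movement down = □ (⟪ moved ⟫ ⇔ X ⟪ counter ⟫)

  movement-stable : ∀ τ m → Stable (τ , 0 ⊨L movement m)
  movement-stable τ stay = negated-stable
  movement-stable τ up   = ×-stable negated-stable negated-stable
  movement-stable τ down = negated-stable

  movement-sound : ∀ τ m {v} → Marker τ counter v → τ , 0 ⊨L movement m →
    ∀ w → T (holds τ w moved) → Moves m v w
  movement-sound τ stay c h w m-w
    with marker⇒≡ τ counter c w (□⇔-elim τ ⟪ moved ⟫ ⟪ counter ⟫ (λ _ → T-stable _) h w m-w)
  ... | refl = stay
  movement-sound τ up c (_ , ¬m-0) zero m-0 = contradiction m-0 ¬m-0
  movement-sound τ up c (h , _) (suc w) m-w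
    with marker⇒≡ τ counter c w (□⇔-elim τ (X ⟪ moved ⟫) ⟪ counter ⟫ (λ _ → T-stable _) h w m-w)
  ... | refl = up
  movement-sound τ down c h w m-w
    with marker⇒≡ τ counter c (suc w) (□⇔-elim τ ⟪ moved ⟫ (X ⟪ counter ⟫) (λ _ → T-stable _) h w m-w)
  ... | refl = down

  movement-complete : ∀ τ m {v w} → Marker τ counter v → Marker τ moved w → Moves m v w →
    τ , 0 ⊨L movement m
  movement-complete τ stay c d stay =
    □-intro τ (⟪ moved ⟫ ⇔ ⟪ counter ⟫) (λ j → ≡⇒T-⇔ (trans (d j) (sym (c j))))
  movement-complete τ up c d up =
    □-intro τ (X ⟪ moved ⟫ ⇔ ⟪ counter ⟫) (λ j → ≡⇒T-⇔ (trans (d (suc j)) (sym (c j))))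
    , subst T (d 0)
  movement-complete τ down c d down =
    □-intro τ (⟪ moved ⟫ ⇔ X ⟪ counter ⟫) (λ j → ≡⇒T-⇔ (trans (d j) (sym (c (suc j)))))

  noSuccessor : Fin L → LTL N
  noSuccessor q = neg ⟪ nextState q ⟫

  outcome : Maybe (Fin L × Move) → LTL N
  outcome nothing        = ⋀ noSuccessor
  outcome (just (j , m)) = stateIs nextState j ∧ movement m

  outcome-stable : ∀ τ o → Stable (τ , 0 ⊨L outcome o)
  outcome-stable τ nothing        = ⋀-stable τ noSuccessor (λ _ → negated-stable)
  outcome-stable τ (just (j , m)) = ×-stable (stateIs-stable τ nextState j) (movement-stable τ m)

  Realises : Tr → ℕ → Maybe (Fin L × Move) → Set
  Realises τ v nothing        = ∀ q → ¬ T (holds τ 0 (nextState q))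
  Realises τ v (just (j , m)) = StateIs τ nextState j × (∀ w → T (holds τ w moved) → Moves m v w)

  outcome-sound : ∀ τ o {v} → Marker τ counter v → τ , 0 ⊨L outcome o → Realises τ v o
  outcome-sound τ nothing        _ h         = ⋀-elim τ noSuccessor h
  outcome-sound τ (just (j , m)) c (s , mv) = stateIs-sound τ nextState j s , movement-sound τ m c mv

  SuccessorMarked : Tr → Bool → Maybe (Config L) → Set
  SuccessorMarked τ b nothing          = ∀ q → ¬ T (holds τ 0 (nextState q))
  SuccessorMarked τ b (just (j , cs′)) = StateIs τ nextState j × Marker τ moved (getC b cs′)

  outcome-complete : ∀ τ {b cs nx o} → Observed b cs nx o → Marker τ counter (getC b cs) →
    SuccessorMarked τ b nx → τ , 0 ⊨L outcome o
  outcome-complete τ halted     _ none  = ⋀-intro τ noSuccessor none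
  outcome-complete τ (moved mv) c (s , d) = stateIs-complete τ nextState _ s , movement-complete τ _ c d mv

  guard : Bool → Bool → Bool → LTL N
  guard b z z′ = lit b (code owner) ∧ (lit z (code counter) ∧ lit z′ (code otherZero))

  clause : Instr L → Bool → Bool → Bool → LTL N
  clause ins b z z′ = guard b z z′ ⇒ outcome (observedStep ins b z z′)

  clauses : Instr L → Bool → Bool → LTL N
  clauses ins b z = ⋀ᵇ (clause ins b z)

  rule : Instr L → LTL N
  rule ins = ⋀ᵇ λ b → ⋀ᵇ (clauses ins b)

  rule-stable : ∀ τ ins → Stable (τ , 0 ⊨L rule ins)
  rule-stable τ ins =
    ⋀ᵇ-stable τ (λ b → ⋀ᵇ (clauses ins b)) λ b →
      ⋀ᵇ-stable τ (clauses ins b) λ z → ⋀ᵇ-stable τ (clause ins b z) λ _ → negated-stable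

  Observation : Tr → Instr L → Maybe (Fin L × Move)
  Observation τ ins = observedStep ins (holds τ 0 owner) (holds τ 0 counter) (holds τ 0 otherZero)

  rule-elim : ∀ τ ins → τ , 0 ⊨L rule ins → ∀ b z z′ → τ , 0 ⊨L clause ins b z z′
  rule-elim τ ins h b z =
    ⋀ᵇ-elim τ (clause ins b z) (⋀ᵇ-elim τ (clauses ins b) (⋀ᵇ-elim τ (λ b → ⋀ᵇ (clauses ins b)) h b) z)

  rule-intro : ∀ τ ins → (∀ b z z′ → τ , 0 ⊨L clause ins b z z′) → τ , 0 ⊨L rule ins
  rule-intro τ ins h =
    ⋀ᵇ-intro τ (λ b → ⋀ᵇ (clauses ins b)) λ b →
      ⋀ᵇ-intro τ (clauses ins b) λ z → ⋀ᵇ-intro τ (clause ins b z) (h b z)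

  rule-sound : ∀ τ ins → τ , 0 ⊨L rule ins → τ , 0 ⊨L outcome (Observation τ ins)
  rule-sound τ ins h =
    ⇒-elim (outcome-stable τ (Observation τ ins))
      (rule-elim τ ins h (holds τ 0 owner) (holds τ 0 counter) (holds τ 0 otherZero))
    (lit-intro τ refl , lit-intro τ refl , lit-intro τ refl)

  rule-complete : ∀ τ ins → τ , 0 ⊨L outcome (Observation τ ins) → τ , 0 ⊨L rule ins
  rule-complete τ ins h = rule-intro τ ins λ b z z′ → ⇒-intro (fires b z z′)
    where
    fires : ∀ b z z′ → τ , 0 ⊨L guard b z z′ → τ , 0 ⊨L outcome (observedStep ins b z z′)
    fires b z z′ (g-b , g-z , g-z′) with lit-elim τ b g-b | lit-elim τ z g-z | lit-elim τ z′ g-z′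
    ... | refl | refl | refl = h

  notInState : Fin L → LTL N
  notInState q = neg ⟪ state q ⟫

  stateRule : Fin L → LTL N
  stateRule q = ⟪ state q ⟫ ⇒ rule (prog q)

  ψ : LTL N
  ψ = □ (neg (X ⟪ init ⟫))
    ∧ (atMostOnce timeSeen time
    ∧ (atMostOnce counterSeen counter
    ∧ (◇ ⟪ time ⟫
    ∧ (□ (X ⟪ next ⟫ ⇒ ⟪ time ⟫)
    ∧ ((⟪ time ⟫ ⇒ (stateIs state zero ∧ ⟪ counter ⟫))
    ∧ (neg (⋀ notInState)
    ∧ ⋀ stateRule))))))

  record Wellformed (τ : Tr) : Set where
    field
      init-only-at-0   : ∀ j → ¬ T (holds τ (suc j) init)
      time-unique      : AtMostOnce τ time
      counter-unique   : AtMostOnce τ counter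
      time-exists      : ∃ λ t → T (holds τ t time)
      time-before-next : ∀ j → T (holds τ (suc j) next) → T (holds τ j time)
      initial          : T (holds τ 0 time) → StateIs τ state zero × T (holds τ 0 counter)
      some-state       : ∃ λ q → T (holds τ 0 (state q))
      rules            : ∀ q → T (holds τ 0 (state q)) → τ , 0 ⊨L rule (prog q)

  ψ-sound : ∀ τ → τ , 0 ⊨L ψ → Wellformed τ
  ψ-sound τ (□¬init , once-time , once-counter , ◇time , □next , initial , some , rules) = record
    { init-only-at-0   = □-elim τ (neg (X ⟪ init ⟫)) (λ _ → negated-stable) □¬init
    ; time-unique      = atMostOnce-sound τ timeSeen time once-time
    ; counter-unique   = atMostOnce-sound τ counterSeen counter once-counter
    ; time-exists      = proj₁ ◇time , proj₁ (proj₂ ◇time)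
    ; time-before-next = ⇒-elim (T-stable _) ∘ □-elim τ (X ⟪ next ⟫ ⇒ ⟪ time ⟫) (λ _ → negated-stable) □next
    ; initial          = λ t-0 →
        let s , c = ⇒-elim (×-stable (stateIs-stable τ state zero) (T-stable _)) initial t-0
        in stateIs-sound τ state zero s , c
    ; some-state       = decidable-stable (any? λ q → T? (holds τ 0 (state q)))
                           λ none → some (⋀-intro τ notInState λ q s-q → none (q , s-q))
    ; rules            = λ q → ⇒-elim (rule-stable τ (prog q)) (⋀-elim τ stateRule rules q)
    }

  -- The HyperLTL specification φ

  -- de Bruijn indices under the prefix ∀π ∃π₁ ∃π₂ ∃π₃ of fragment 3
  vπ vπ₁ vπ₂ vπ₃ : Fin 4
  vπ  = suc (suc (suc zero))
  vπ₁ = suc (suc zero)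
  vπ₂ = suc zero
  vπ₃ = zero

  stateFlow finalHalted : Fin L → Body N 4
  stateFlow q   = nextState q ⟨ vπ₁ ⟩ ⇔ᴮ state q ⟨ vπ ⟩
  finalHalted q = neg (nextState q ⟨ vπ₃ ⟩)

  φ-time φ-counter φ-local : Body N 4
  φ-time    = (time ⟨ vπ ⟩ ∧ time ⟨ vπ₂ ⟩) ∧ (init ⟨ vπ ⟩ ∨ᴮ next ⟨ vπ₁ ⟩)
  φ-counter = (init ⟨ vπ ⟩ ∧ time ⟨ vπ ⟩) ∨ᴮ (counter ⟨ vπ ⟩ ∧ moved ⟨ vπ₁ ⟩)
  φ-local   = (owner ⟨ vπ₁ ⟩ ⇔ᴮ owner ⟨ vπ ⟩)
            ∧ ((owner ⟨ vπ₂ ⟩ ⇔ᴮ neg (owner ⟨ vπ ⟩))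
            ∧ ((otherZero ⟨ vπ ⟩ ⇔ᴮ counter ⟨ vπ₂ ⟩)
            ∧ ((time ⟨ vπ ⟩ ∨ᴮ ⋀ᴮ stateFlow)
            ∧ ⋀ᴮ finalHalted)))

  φ-time-noTemporal : NoTemporal φ-time
  φ-time-noTemporal = and (and (atom _ _) (atom _ _)) (∨ᴮ-noTemporal (atom _ _) (atom _ _))

  φ-counter-noTemporal : NoTemporal φ-counter
  φ-counter-noTemporal = ∨ᴮ-noTemporal (and (atom _ _) (atom _ _)) (and (atom _ _) (atom _ _))

  φ-local-noTemporal : NoTemporal φ-local
  φ-local-noTemporal =
    and (⇔ᴮ-noTemporal (atom _ _) (atom _ _))
    (and (⇔ᴮ-noTemporal (atom _ _) (neg (atom _ _)))
    (and (⇔ᴮ-noTemporal (atom _ _) (atom _ _))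
    (and (∨ᴮ-noTemporal (atom _ _) (⋀ᴮ-noTemporal stateFlow λ _ → ⇔ᴮ-noTemporal (atom _ _) (atom _ _)))
    (⋀ᴮ-noTemporal finalHalted λ _ → neg (atom _ _)))))

  φ : HyperLTL N
  φ = fragment 3 φ-time φ-counter φ-local

  assignment : Tr → Tr → Tr → Tr → Fin 4 → Tr
  assignment τ τ₁ τ₂ τ₃ = extend τ₃ (extend τ₂ (extend τ₁ (extend τ emptyAssign)))

  record Obligation (τ τ₁ τ₂ τ₃ : Tr) : Set where
    field
      synchronised    : ∃ λ j → T (holds τ j time) × T (holds τ₂ j time)
                                × (T (holds τ j init) ⊎ T (holds τ₁ j next))
      counterFollows  : ∃ λ j → (T (holds τ j init) × T (holds τ j time))
                              ⊎ (T (holds τ j counter) × T (holds τ₁ j moved))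
      sameOwner       : holds τ₁ 0 owner ≡ holds τ 0 owner
      otherOwner      : holds τ₂ 0 owner ≡ not (holds τ 0 owner)
      otherZeroAgrees : holds τ 0 otherZero ≡ holds τ₂ 0 counter
      stateFollows    : T (holds τ 0 time) ⊎ (∀ q → holds τ₁ 0 (nextState q) ≡ holds τ 0 (state q))
      finalIsHalted   : ∀ q → ¬ T (holds τ₃ 0 (nextState q))

  obligation-sound : ∀ τ τ₁ τ₂ τ₃ →
    assignment τ τ₁ τ₂ τ₃ , 0 ⊨B ((F φ-time ∧ F φ-counter) ∧ φ-local) → Obligation τ τ₁ τ₂ τ₃
  obligation-sound τ τ₁ τ₂ τ₃
    (((j , ((t , t₂) , i∨n) , _) , (k , c , _)) , o₁ , o₂ , z , flow , final) = record
    { synchronised    = j , t , t₂ , ∨-elim (T? _) (T-stable _) i∨n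
    ; counterFollows  = k , ∨-elim (T? _ ×-dec T? _) (×-stable (T-stable _) (T-stable _)) c
    ; sameOwner       = T-⇔⇒≡ o₁
    ; otherOwner      = T-⇔¬⇒≡not o₂
    ; otherZeroAgrees = T-⇔⇒≡ z
    ; stateFollows    = map₂ (λ h q → T-⇔⇒≡ (⋀ᴮ-elim Π stateFlow h q))
                          (∨-elim (T? _) (⋀ᴮ-stable Π stateFlow λ _ → ⇔-stable) flow)
    ; finalIsHalted   = ⋀ᴮ-elim Π finalHalted final
    }
    where Π = assignment τ τ₁ τ₂ τ₃

  obligation-complete : ∀ τ τ₁ τ₂ τ₃ → Obligation τ τ₁ τ₂ τ₃ →
    assignment τ τ₁ τ₂ τ₃ , 0 ⊨B ((F φ-time ∧ F φ-counter) ∧ φ-local)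
  obligation-complete τ τ₁ τ₂ τ₃ o =
    let j , t , t₂ , i⊎n = synchronised
        k , c            = counterFollows
    in ( F-intro Π φ-time j ((t , t₂) , [ ∨-introˡ , ∨-introʳ ]′ i⊎n)
       , F-intro Π φ-counter k ([ ∨-introˡ , ∨-introʳ ]′ c) )
       , ≡⇒T-⇔ sameOwner , ≡not⇒T-⇔¬ otherOwner , ≡⇒T-⇔ otherZeroAgrees
       , [ ∨-introˡ , (λ flow → ∨-introʳ (⋀ᴮ-intro Π stateFlow λ q → ≡⇒T-⇔ (flow q))) ]′ stateFollows
       , ⋀ᴮ-intro Π finalHalted finalIsHalted
    where
    open Obligation o
    Π = assignment τ τ₁ τ₂ τ₃

  -- A model of (ψ, φ) yields a halting run

  Represents : Tr → Config L → Set
  Represents τ (q , cs) = StateIs τ state q × Marker τ counter (getC (holds τ 0 owner) cs)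

  observes-step : ∀ τ {q} x y → Marker τ counter (getC (holds τ 0 owner) (x , y)) →
    holds τ 0 otherZero ≡ (0 ≡ᵇ getC (not (holds τ 0 owner)) (x , y)) →
    Observed (holds τ 0 owner) (x , y) (step M (q , x , y)) (Observation τ (prog q))
  observes-step τ {q} x y c z rewrite c 0 | z = step-observed M (holds τ 0 owner) q x y

  successor-represented : ∀ {τ τ₁ b cs nx o} → Wellformed τ → Observed b cs nx o →
    Realises τ₁ (getC b cs) o → (∀ q → holds τ₁ 0 (nextState q) ≡ holds τ 0 (state q)) →
    (∃ λ w → T (holds τ w counter) × T (holds τ₁ w moved)) → holds τ 0 owner ≡ b →
    ∃ λ c′ → nx ≡ just c′ × Represents τ c′
  successor-represented wf halted none flows _ _ =
    let q , s-q = Wellformed.some-state wf in contradiction (subst T (sym (flows q)) s-q) (none q)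
  successor-represented {τ} wf (moved v→w) (next≡ , moves) flows (w , c-w , m-w) refl =
    _ , refl , (λ q → trans (sym (flows q)) (next≡ q))
      , unique⇒marker τ counter (Wellformed.counter-unique wf)
          (subst (λ k → T (holds τ k counter)) (Moves-functional (moves w m-w) v→w) c-w)

  halted-configuration : ∀ {τ b cs v nx o} → Observed b cs nx o → Realises τ v o →
    (∀ q → ¬ T (holds τ 0 (nextState q))) → nx ≡ nothing
  halted-configuration halted           _         _    = refl
  halted-configuration {τ} (moved {j = j} _) (next≡ , _) none =
    contradiction (stateIs-self τ nextState j next≡) (none j)

  module Extraction (S : Tr → Set) (S⊨ψ : ∀ τ → S τ → τ , 0 ⊨L ψ) (S⊨φ : S ⊨ φ) where

    wellformed : ∀ {τ} → S τ → Wellformed τ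
    wellformed {τ} τ∈ = ψ-sound τ (S⊨ψ τ τ∈)

    record Witnesses (τ : Tr) : Set where
      field
        {predecessor twin final} : Tr
        predecessor∈ : S predecessor
        twin∈        : S twin
        final∈       : S final
        obligation   : Obligation τ predecessor twin final

    witnesses : ∀ {τ} → S τ → Witnesses τ
    witnesses {τ} τ∈ with S⊨φ τ τ∈
    ... | τ₁ , τ₁∈ , τ₂ , τ₂∈ , τ₃ , τ₃∈ , sat = record
      { predecessor∈ = τ₁∈ ; twin∈ = τ₂∈ ; final∈ = τ₃∈ ; obligation = obligation-sound τ τ₁ τ₂ τ₃ sat }

    module _ {τ} (τ∈ : S τ) {t} (τ-at-t : T (holds τ t time)) where
      open Witnesses (witnesses τ∈)
      open Obligation obligation
      open Wellformed (wellformed τ∈)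

      twin-at : T (holds twin t time)
      twin-at with synchronised
      ... | j , τ-at-j , twin-at-j , _ =
        subst (λ k → T (holds twin k time)) (time-unique j t τ-at-j τ-at-t) twin-at-j

    RepresentedAt : ℕ → Set
    RepresentedAt t = ∀ {τ} → S τ → T (holds τ t time) → ∃ λ c → run M t ≡ just c × Represents τ c

    module _ {τ} (τ∈ : S τ) {t} (τ-at : T (holds τ (suc t) time)) where
      open Witnesses (witnesses τ∈)
      open Obligation obligation
      open Wellformed (wellformed τ∈)

      not-initial : ∀ j → T (holds τ j time) → ¬ T (holds τ j init)
      not-initial j τ-at-j =
        subst (λ k → ¬ T (holds τ k init)) (sym (time-unique j (suc t) τ-at-j τ-at)) (init-only-at-0 t)

      predecessor-at : T (holds predecessor t time)
      predecessor-at with synchronised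
      ... | j , τ-at-j , _ , inj₁ init-j = contradiction init-j (not-initial j τ-at-j)
      ... | j , τ-at-j , _ , inj₂ next-j =
        Wellformed.time-before-next (wellformed predecessor∈) t
          (subst (λ k → T (holds predecessor k next)) (time-unique j (suc t) τ-at-j τ-at) next-j)

      counter-meets : ∃ λ w → T (holds τ w counter) × T (holds predecessor w moved)
      counter-meets with counterFollows
      ... | j , inj₁ (init-j , τ-at-j) = contradiction init-j (not-initial j τ-at-j)
      ... | j , inj₂ meet              = j , meet

      state-flows : ∀ q → holds predecessor 0 (nextState q) ≡ holds τ 0 (state q)
      state-flows with stateFollows
      ... | inj₁ τ-at-0 = contradiction (time-unique 0 (suc t) τ-at-0 τ-at) λ ()
      ... | inj₂ flows  = flows

    realises-step : ∀ {t} → RepresentedAt t → ∀ {τ q x y} → S τ → T (holds τ t time) →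
      run M t ≡ just (q , x , y) → Represents τ (q , x , y) →
      ∃ λ o → Observed (holds τ 0 owner) (x , y) (step M (q , x , y)) o
            × Realises τ (getC (holds τ 0 owner) (x , y)) o
    realises-step rep {τ} {q} {x} {y} τ∈ τ-at run-t (s , c) =
      Observation τ (prog q) , observes-step τ x y c other-zero ,
      outcome-sound τ _ c (rule-sound τ (prog q) (rules q (stateIs-self τ state q s)))
      where
      open Witnesses (witnesses τ∈)
      open Obligation obligation
      open Wellformed (wellformed τ∈)
      -- the twin observes the other counter of the same configuration
      other-zero : holds τ 0 otherZero ≡ (0 ≡ᵇ getC (not (holds τ 0 owner)) (x , y))
      other-zero with rep twin∈ (twin-at τ∈ τ-at)
      ... | c′ , run-t′ , _ , c-twin with trans (sym run-t) run-t′
      ... | refl = trans otherZeroAgrees (trans (c-twin 0) (cong (λ b → 0 ≡ᵇ getC b (x , y)) otherOwner))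

    represented : ∀ t → RepresentedAt t
    represented zero {τ} τ∈ τ-at =
      (zero , 0 , 0) , refl , proj₁ start ,
      subst (Marker τ counter) (sym (getC-zeros (holds τ 0 owner)))
        (unique⇒marker τ counter counter-unique (proj₂ start))
      where
      open Wellformed (wellformed τ∈)
      start = initial τ-at
    represented (suc t) {τ} τ∈ τ-at =
      let (q , x , y) , run-t , rep₁ = represented t predecessor∈ predecessor-at′
          _ , observed , realised    = realises-step (represented t) predecessor∈ predecessor-at′ run-t rep₁
          c′ , next≡ , rep           = successor-represented (wellformed τ∈) observed realised
                                         (state-flows τ∈ τ-at) (counter-meets τ∈ τ-at) (sym sameOwner)
      in c′ , trans (run-suc M {t} run-t) next≡ , rep
      where
      open Witnesses (witnesses τ∈)
      open Obligation obligation
      predecessor-at′ = predecessor-at τ∈ τ-at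

    halts : ∃ S → Halts M
    halts (τ , τ∈) =
      let t , final-at                = Wellformed.time-exists (wellformed final∈)
          (q , x , y) , run-t , rep   = represented t final∈ final-at
          _ , observed , realised     = realises-step (represented t) final∈ final-at run-t rep
      in suc t , trans (run-suc M {t} run-t) (halted-configuration observed realised finalIsHalted)
      where
      open Witnesses (witnesses τ∈)
      open Obligation obligation

  -- A halting run yields a model of (ψ, φ)

  successorState : Maybe (Config L) → Fin L → Bool
  successorState nothing        _ = false
  successorState (just (j , _)) q = does (q ≟ᶠ j)

  movedMarker : Bool → Maybe (Config L) → ℕ → Bool
  movedMarker b nothing          _ = false
  movedMarker b (just (_ , cs′)) i = i ≡ᵇ getC b cs′

  valuation : ℕ → Bool → Config L → Maybe (Config L) → ℕ → Atom → Bool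
  valuation t b (q , cs) nx i init          = i ≡ᵇ 0
  valuation t b (q , cs) nx i time          = i ≡ᵇ t
  valuation t b (q , cs) nx i next          = i ≡ᵇ suc t
  valuation t b (q , cs) nx i counter       = i ≡ᵇ getC b cs
  valuation t b (q , cs) nx i moved         = movedMarker b nx i
  valuation t b (q , cs) nx i timeSeen      = t <ᵇ i
  valuation t b (q , cs) nx i counterSeen   = getC b cs <ᵇ i
  valuation t b (q , cs) nx i owner         = b
  valuation t b (q , cs) nx i otherZero     = 0 ≡ᵇ getC (not b) cs
  valuation t b (q , cs) nx i (state q′)     = does (q′ ≟ᶠ q)
  valuation t b (q , cs) nx i (nextState q′) = successorState nx q′

  encode : ℕ → Bool → Config L → Maybe (Config L) → Tr
  encode t b c nx i x = valuation t b c nx i (decode x)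

  holds-encode : ∀ t b c nx i a → holds (encode t b c nx) i a ≡ valuation t b c nx i a
  holds-encode t b c nx i a = cong (valuation t b c nx i) (decode-code a)

  configTrace : ℕ → Bool → Config L → Tr
  configTrace t b c = encode t b c (step M c)

  successor-marked : ∀ t b c nx → SuccessorMarked (encode t b c nx) b nx
  successor-marked t b c nothing          q = subst T (holds-encode t b c nothing 0 (nextState q))
  successor-marked t b c (just (j , cs′)) =
    (λ q → holds-encode t b c (just (j , cs′)) 0 (nextState q)) , λ _ → refl

  encode-⊨ψ : ∀ t b q x y → (t ≡ 0 → (q , x , y) ≡ (zero , 0 , 0)) → configTrace t b (q , x , y) , 0 ⊨L ψ
  encode-⊨ψ t b q x y initial-at-0 =
      □-intro τ (neg (X ⟪ init ⟫)) (λ _ ())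
    , atMostOnce-complete τ timeSeen time t (λ _ → refl) (λ _ → refl)
    , atMostOnce-complete τ counterSeen counter (getC b (x , y)) (λ _ → refl) (λ _ → refl)
    , ◇-intro τ ⟪ time ⟫ t (≡ᵇ-refl t)
    , □-intro τ (X ⟪ next ⟫ ⇒ ⟪ time ⟫) (λ _ → ⇒-intro id)
    , ⇒-intro start
    , (λ none → ⋀-elim τ notInState none q (stateIs-self τ state q in-q))
    , ⋀-intro τ stateRule
        (λ q′ → ⇒-intro λ s-q′ → subst (λ p → τ , 0 ⊨L rule (prog p)) (sym (at-q q′ s-q′)) rule-q)
    where
    τ = configTrace t b (q , x , y)
    in-q : StateIs τ state q
    in-q q′ = holds-encode t b (q , x , y) _ 0 (state q′)
    at-q : ∀ q′ → T (holds τ 0 (state q′)) → q′ ≡ q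
    at-q q′ s-q′ = toWitness (subst T (trans (in-q q′) (sym (isYes≗does (q′ ≟ᶠ q)))) s-q′)
    rule-q : τ , 0 ⊨L rule (prog q)
    rule-q = rule-complete τ (prog q)
      (outcome-complete τ (observes-step τ x y (λ _ → refl) refl) (λ _ → refl)
        (successor-marked t b (q , x , y) _))
    start : T (holds τ 0 time) → τ , 0 ⊨L (stateIs state zero ∧ ⟪ counter ⟫)
    start t-0 with initial-at-0 (sym (≡ᵇ⇒≡ 0 t t-0))
    ... | refl = stateIs-complete τ state zero in-q , subst (λ v → T (0 ≡ᵇ v)) (sym (getC-zeros b)) _

  Reachable : Tr → Set
  Reachable τ = ∃ λ t → ∃ λ b → ∃ λ c → run M t ≡ just c × τ ≡ configTrace t b c

  reachable-⊨ψ : ∀ τ → Reachable τ → τ , 0 ⊨L ψ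
  reachable-⊨ψ _ (t , b , (q , x , y) , run-t , refl) = encode-⊨ψ t b q x y initial
    where
    initial : t ≡ 0 → (q , x , y) ≡ (zero , 0 , 0)
    initial refl = sym (just-injective run-t)

  module Construction {t-end c-end} (run-end : run M t-end ≡ just c-end) (stops : step M c-end ≡ nothing)
    where

    final : Tr
    final = configTrace t-end false c-end

    final-halted : ∀ q → ¬ T (holds final 0 (nextState q))
    final-halted q = subst (λ nx → ¬ T (holds (encode t-end false c-end nx) 0 (nextState q))) (sym stops)
                       (successor-marked t-end false c-end nothing q)

    WitnessedBy : Tr → Set
    WitnessedBy τ = ∃ λ τ₁ → Reachable τ₁ × ∃ λ τ₂ → Reachable τ₂ × Obligation τ τ₁ τ₂ final

    initial-witnessed : ∀ b c → run M 0 ≡ just c → WitnessedBy (configTrace 0 b c)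
    initial-witnessed b c run-0 =
      configTrace 0 b c , (0 , b , c , run-0 , refl) ,
      configTrace 0 (not b) c , (0 , not b , c , run-0 , refl) ,
      record
        { synchronised    = 0 , _ , _ , inj₁ _
        ; counterFollows  = 0 , inj₁ (_ , _)
        ; sameOwner       = refl
        ; otherOwner      = refl
        ; otherZeroAgrees = refl
        ; stateFollows    = inj₁ _
        ; finalIsHalted   = final-halted
        }

    successor-obligation : ∀ t b c₀ c →
      Obligation (configTrace (suc t) b c) (encode t b c₀ (just c)) (configTrace (suc t) (not b) c) final
    successor-obligation t b c₀ (q , cs) = record
      { synchronised    = suc t , ≡ᵇ-refl t , ≡ᵇ-refl t , inj₂ (≡ᵇ-refl t)
      ; counterFollows  = getC b cs , inj₂ (≡ᵇ-refl (getC b cs) , ≡ᵇ-refl (getC b cs))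
      ; sameOwner       = refl
      ; otherOwner      = refl
      ; otherZeroAgrees = refl
      ; stateFollows    = inj₂ λ q′ →
          trans (holds-encode t b c₀ (just (q , cs)) 0 (nextState q′))
                (sym (holds-encode (suc t) b (q , cs) _ 0 (state q′)))
      ; finalIsHalted   = final-halted
      }

    successor-witnessed : ∀ t b c → run M (suc t) ≡ just c → WitnessedBy (configTrace (suc t) b c)
    successor-witnessed t b c run-t+1 =
      let c₀ , run-t , step≡ = run-pred M t run-t+1
      in configTrace t b c₀ , (t , b , c₀ , run-t , refl) ,
         configTrace (suc t) (not b) c , (suc t , not b , c , run-t+1 , refl) ,
         subst (λ nx → Obligation (configTrace (suc t) b c) (encode t b c₀ nx)
                                  (configTrace (suc t) (not b) c) final)
           (sym step≡) (successor-obligation t b c₀ c)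

    reachable-⊨φ : Reachable ⊨ φ
    reachable-⊨φ _ (t , b , c , run-t , refl) =
      let τ₁ , τ₁∈ , τ₂ , τ₂∈ , o = witnessed t run-t
      in τ₁ , τ₁∈ , τ₂ , τ₂∈ , final , (t-end , false , c-end , run-end , refl)
         , obligation-complete _ τ₁ τ₂ final o
      where
      witnessed : ∀ t → run M t ≡ just c → WitnessedBy (configTrace t b c)
      witnessed zero    = initial-witnessed b c
      witnessed (suc t) = successor-witnessed t b c

  halts⇒satisfiable : Halts M → Satisfiable ψ φ
  halts⇒satisfiable (s , run-s) =
    let t , c , run-t , stops = run-last M s run-s
    in Reachable , (configTrace 0 false (zero , 0 , 0) , 0 , false , _ , refl , refl) , reachable-⊨ψ ,
       Construction.reachable-⊨φ {t} run-t stops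

  satisfiable⇒halts : Satisfiable ψ φ → Halts M
  satisfiable⇒halts (S , nonempty , S⊨ψ , S⊨φ) = Extraction.halts S S⊨ψ S⊨φ nonempty


lemma4p12 : ((n : ℕ) (ψ : LTL n) (k : ℕ) (φ₁ φ₂ φ' : Body n (suc k))
              → NoTemporal φ₁ → NoTemporal φ₂ → NoTemporal φ'
              → Dec (Satisfiable ψ (fragment k φ₁ φ₂ φ')))
            → (M : Minsky) → Dec (Halts M)
lemma4p12 decide M =
  map′ satisfiable⇒halts halts⇒satisfiable
    (decide N ψ 3 φ-time φ-counter φ-local φ-time-noTemporal φ-counter-noTemporal φ-local-noTemporal)
  where open Reduction M
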